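{- Let $\sigma_k$ be the partition of $[k]$ into $k$ singleton blocks and $\beta_k$ the partition of $[k]$ with one block. For all $k\ge 2$ and $n\ge 1$, $|\Pi_n(\sigma_k)|\le|\Pi_n(\beta_k)|$, and this inequality is strict whenever $n>k>2$.
   Context: The standardization of a set partition of a finite set $S\subset\mathbb{Z}_{>0}$ replaces the $i$-th smallest element of $S$ by $i$. A set partition $\pi$ of $[n]$ contains $\tau\vdash[k]$ if for some $S\subseteq[n]$ the standardization of the restriction of $\pi$ to $S$ is $\tau$; otherwise it avoids $\tau$. $\Pi_n(\tau)$ is the set of set partitions of $[n]$ avoiding $\tau$ (for $n<k$ this is all set partitions of $[n]$). -}

module Defs where

open import Data.Nat using (ℕ; _<_)
open import Data.Bool using (Bool; true; false; _∧_)
open import Data.Fin using (Fin) renaming (_<_ to _<ᶠ_)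
open import Data.Fin.Properties using (_≟_)
open import Data.Vec using (Vec; lookup; tabulate)
open import Data.Vec.Properties using (lookup∘tabulate)
open import Data.Product using (Σ; ∃; _×_; _,_)
open import Relation.Nullary using (¬_; does)
open import Relation.Binary.PropositionalEquality using (_≡_; refl; sym; trans; subst)
open import Function.Bundles using (_↔_)

-- A set partition of [n] = Fin n is encoded by its equivalence relation
-- "i and j lie in the same block", stored as an n×n Boolean matrix.
Rel : ℕ → Set
Rel n = Vec (Vec Bool n) n

_∼[_]_ : ∀ {n} → Fin n → Rel n → Fin n → Bool
i ∼[ R ] j = lookup (lookup R i) j

record IsEquivalenceRel {n : ℕ} (R : Rel n) : Set where
  field
    rfl : ∀ i → i ∼[ R ] i ≡ true
    sym′ : ∀ i j → i ∼[ R ] j ≡ true → j ∼[ R ] i ≡ true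
    trans′ : ∀ i j l → i ∼[ R ] j ≡ true → j ∼[ R ] l ≡ true → i ∼[ R ] l ≡ true

-- Set partitions of [n] (proof of the equivalence axioms is irrelevant,
-- so a partition is determined by its block relation).
record SetPartition (n : ℕ) : Set where
  constructor mkSP
  field
    rel : Rel n
    .isEquiv : IsEquivalenceRel rel
open SetPartition public

-- π ⊢ [n] contains τ ⊢ [k]: there is a k-subset S of [n], listed increasingly
-- as f 0 < f 1 < ... < f (k-1), such that the standardization of π restricted
-- to S is τ, i.e. f i and f j are in the same block of π iff i, j are in the
-- same block of τ.
Contains : ∀ {n k} → SetPartition n → SetPartition k → Set
Contains {n} {k} π τ =
  Σ (Fin k → Fin n) λ f →
    (∀ i j → i <ᶠ j → f i <ᶠ f j) ×
    (∀ i j → f i ∼[ rel π ] f j ≡ i ∼[ rel τ ] j)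

Avoids : ∀ {n k} → SetPartition n → SetPartition k → Set
Avoids π τ = ¬ Contains π τ

record Π {k : ℕ} (n : ℕ) (τ : SetPartition k) : Set where
  constructor mkΠ
  field
    part : SetPartition n
    .avoids : Avoids part τ

HasSize : Set → ℕ → Set
HasSize A m = A ↔ Fin m

σ-rel : (k : ℕ) → Rel k
σ-rel k = tabulate λ i → tabulate λ j → does (i ≟ j)

β-rel : (k : ℕ) → Rel k
β-rel k = tabulate λ i → tabulate λ j → true

private
  σ-at : ∀ {k} (i j : Fin k) → i ∼[ σ-rel k ] j ≡ does (i ≟ j)
  σ-at {k} i j rewrite lookup∘tabulate (λ i → tabulate λ j → does (i ≟ j)) i
                     = lookup∘tabulate (λ j → does (i ≟ j)) j

  β-at : ∀ {k} (i j : Fin k) → i ∼[ β-rel k ] j ≡ true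
  β-at {k} i j rewrite lookup∘tabulate (λ (i : Fin k) → tabulate λ (j : Fin k) → true) i
                     = lookup∘tabulate (λ (j : Fin k) → true) j

  eqFromDoes : ∀ {k} (i j : Fin k) → does (i ≟ j) ≡ true → i ≡ j
  eqFromDoes i j p with i ≟ j
  ... | Relation.Nullary.yes e = e
  eqFromDoes i j () | Relation.Nullary.no _

  doesRefl : ∀ {k} (i : Fin k) → does (i ≟ i) ≡ true
  doesRefl i with i ≟ i
  ... | Relation.Nullary.yes _ = refl
  ... | Relation.Nullary.no ¬p = Data.Empty.⊥-elim (¬p refl)
    where import Data.Empty

  σ-equiv : ∀ k → IsEquivalenceRel (σ-rel k)
  σ-equiv k = record
    { rfl = λ i → trans (σ-at i i) (doesRefl i)
    ; sym′ = λ i j p → let e = eqFromDoes i j (trans (sym (σ-at i j)) p)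
                       in subst (λ x → x ∼[ σ-rel k ] i ≡ true) e
                            (trans (σ-at i i) (doesRefl i))
    ; trans′ = λ i j l p q →
        let e₁ = eqFromDoes i j (trans (sym (σ-at i j)) p)
        in subst (λ x → x ∼[ σ-rel k ] l ≡ true) (sym e₁) q
    }

  β-equiv : ∀ k → IsEquivalenceRel (β-rel k)
  β-equiv k = record
    { rfl = λ i → β-at i i
    ; sym′ = λ i j _ → β-at j i
    ; trans′ = λ i j l _ _ → β-at i l
    }

σ : (k : ℕ) → SetPartition k
σ k = mkSP (σ-rel k) (σ-equiv k)

β : (k : ℕ) → SetPartition k
β k = mkSP (β-rel k) (β-equiv k)

{-# OPTIONS --safe #-}
module Submission where

-- Write m = k - 1, u = eˣ - 1 and G_m = Σ_{j ≤ m} uʲ/j!, the exponential generating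
-- function of the partitions into at most m blocks; those with all blocks of size
-- at most m are counted by B with B′ = (Σ_{i < m} xⁱ/i!) B. Coefficientwise induction
-- reduces a ≤ b to G_m′ = eˣ G_{m-1} ≤ (Σ_{i < m} xⁱ/i!) G_m, and cancelling
-- (Σ_{i < m} xⁱ/i!) G_{m-1} on both sides leaves, term by term for j < m,
-- (Σ_{i ≥ m} xⁱ/i!) uʲ/j! ≤ (xʲ/j!) (uᵐ/m!). This follows from
-- m! Σ_{i ≥ m} xⁱ/i! ≤ xᵐ⁻¹ u and x ≤ u. The term j = 0 is strict in degrees
-- above m when m ≥ 2.

-- Both counts are instances of one: partitions with at most `D` blocks, all of size at most `s`,
-- have generating function Σ_{j ≤ D} γʲ/j! with γ = Σ_{1 ≤ i ≤ s} xⁱ/i!. Avoiding σ_k means `D` =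
-- m, avoiding β_k means `s` = m, and the other parameter is set to n. The number of restricted
-- growth words alone has no simple recursion, since the choices for the next letter depend on how
-- full each block is. So each word carries the series of all its completions: a product with one
-- factor per open block and one for the blocks still to be opened. Its Leibniz expansion lists
-- exactly the choices for the next letter. Storing n! [xⁿ] keeps everything in ℕ: the derivative is
-- a shift, γ enters only through γ′, and denominators disappear on multiplying by factorials.

open import Defs
open import Data.Bool using (Bool; true; false)
import Data.Bool.Properties as Bool
open import Data.Bool.Properties using (⇔→≡; ¬-not)
open import Data.Fin using (Fin; zero; suc; toℕ; fromℕ<) renaming (_<_ to _<ᶠ_)
import Data.Fin.Properties as Fin
open import Data.Fin.Properties using (any?; pigeonhole; fromℕ<-injective)
open import Data.List as List using (List; []; _∷_; map; filter; concatMap; downFrom; length; _++_)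
open import Data.List.Properties
  using (map-++; map-∘; map-cong-local; filter-accept; filter-reject; length-map)
open import Data.List.Membership.Propositional using (_∈_)
open import Data.List.Membership.Propositional.Properties
  using (∈-filter⁺; ∈-filter⁻; ∈-downFrom⁺; ∈-downFrom⁻; ∈-concatMap⁺; ∈-map⁺; ∈-map⁻; ∈-lookup)
open import Data.List.Relation.Binary.Disjoint.Propositional using (Disjoint)
open import Data.List.Relation.Unary.All as All using (All; []; _∷_)
import Data.List.Relation.Unary.All.Properties as All
open import Data.List.Relation.Unary.AllPairs as AllPairs using ([]; _∷_)
import Data.List.Relation.Unary.AllPairs.Properties as AllPairs
open import Data.List.Relation.Unary.Any as Any using (here)
open import Data.List.Relation.Unary.Any.Properties using (lookup-index)
open import Data.List.Relation.Unary.Unique.Propositional using (Unique)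
import Data.List.Relation.Unary.Unique.Propositional.Properties as Unique
open import Data.Nat.ListAction using (sum)
open import Data.Nat.ListAction.Properties using (sum-++)
open import Data.Vec using (Vec; []; _∷_; count; lookup; tabulate)
open import Data.Vec.Properties
  using (∷-injectiveˡ; ∷-injectiveʳ; count≤n; ≡-dec; lookup∘tabulate; tabulate∘lookup; tabulate-cong)
open import Function.Bundles using (mk⇔; mk↔ₛ′)
open import Relation.Nullary using (Dec; yes; no; does; ¬_; contradiction)
open import Relation.Nullary.Decidable using (dec-true; dec-false; _×-dec_; recompute)
open import Relation.Unary using (Decidable)
open import Data.Nat using (ℕ; zero; suc; _+_; _*_; _∸_; _⊔_; _!; _≤_; _<_; z≤n; s≤s; z<s; s<s; _<?_; _≤?_; _≟_)
open import Data.Nat.Properties hiding (_≟_; _≤?_; _<?_)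
open import Algebra.Properties.CommutativeSemigroup +-commutativeSemigroup using (interchange)
open import Data.Product using (Σ; ∃; _×_; _,_; proj₁; proj₂)
open import Relation.Binary.PropositionalEquality
  using (_≡_; _≢_; _≗_; refl; sym; trans; cong; cong₂; subst; subst₂; ≢-sym; module ≡-Reasoning)

-- Exponential generating functions

-- A sequence f stands for its exponential generating function Σ f(n) xⁿ/n!:
-- δ is the derivative, _⊗_ the product (the Leibniz rule is its definition).
Seq : Set
Seq = ℕ → ℕ

infixl 6 _⊕_
infixl 7 _⊗_ _·_
infix 4 _≼_

δ : Seq → Seq
δ f n = f (suc n)

_⊕_ : Seq → Seq → Seq
(f ⊕ g) n = f n + g n

_·_ : ℕ → Seq → Seq
(c · f) n = c * f n

_⊗_ : Seq → Seq → Seq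
(f ⊗ g) zero = f 0 * g 0
(f ⊗ g) (suc n) = (δ f ⊗ g) n + (f ⊗ δ g) n

_≼_ : Seq → Seq → Set
f ≼ g = ∀ n → f n ≤ g n

0# : Seq
0# _ = 0

-- Degree `n` of a product sees only degrees up to `n` of its factors; the induction in `bell≤` has
-- no more than that available.
⊗-mono-upto : ∀ {f f′ g g′ : Seq} n → (∀ i → i ≤ n → f i ≤ f′ i) →
  (∀ i → i ≤ n → g i ≤ g′ i) → (f ⊗ g) n ≤ (f′ ⊗ g′) n
⊗-mono-upto zero p q = *-mono-≤ (p 0 z≤n) (q 0 z≤n)
⊗-mono-upto (suc n) p q = +-mono-≤
  (⊗-mono-upto n (λ i le → p (suc i) (s≤s le)) (λ i le → q i (m≤n⇒m≤1+n le)))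
  (⊗-mono-upto n (λ i le → p i (m≤n⇒m≤1+n le)) (λ i le → q (suc i) (s≤s le)))

⊗-mono : ∀ {f f′ g g′} → f ≼ f′ → g ≼ g′ → f ⊗ g ≼ f′ ⊗ g′
⊗-mono p q n = ⊗-mono-upto n (λ i _ → p i) (λ i _ → q i)

⊗-cong : ∀ {f f′ g g′} → f ≗ f′ → g ≗ g′ → f ⊗ g ≗ f′ ⊗ g′
⊗-cong p q n = ≤-antisym
  (⊗-mono (λ i → ≤-reflexive (p i)) (λ i → ≤-reflexive (q i)) n)
  (⊗-mono (λ i → ≤-reflexive (sym (p i))) (λ i → ≤-reflexive (sym (q i))) n)

⊗-congˡ : ∀ f {g g′} → g ≗ g′ → f ⊗ g ≗ f ⊗ g′
⊗-congˡ f = ⊗-cong {f} (λ _ → refl)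

⊗-congʳ : ∀ {f f′} g → f ≗ f′ → f ⊗ g ≗ f′ ⊗ g
⊗-congʳ g p = ⊗-cong {g = g} p (λ _ → refl)

⊗-comm : ∀ f g → f ⊗ g ≗ g ⊗ f
⊗-comm f g zero = *-comm (f 0) (g 0)
⊗-comm f g (suc n) =
  trans (cong₂ _+_ (⊗-comm (δ f) g n) (⊗-comm f (δ g) n)) (+-comm ((g ⊗ δ f) n) _)

⊗-distribˡ : ∀ f g h → f ⊗ (g ⊕ h) ≗ f ⊗ g ⊕ f ⊗ h
⊗-distribˡ f g h zero = *-distribˡ-+ (f 0) (g 0) (h 0)
⊗-distribˡ f g h (suc n) =
  trans (cong₂ _+_ (⊗-distribˡ (δ f) g h n) (⊗-distribˡ f (δ g) (δ h) n))
        (interchange ((δ f ⊗ g) n) _ _ _)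

⊗-distribʳ : ∀ f g h → (g ⊕ h) ⊗ f ≗ g ⊗ f ⊕ h ⊗ f
⊗-distribʳ f g h n = trans (⊗-comm (g ⊕ h) f n)
  (trans (⊗-distribˡ f g h n) (cong₂ _+_ (⊗-comm f g n) (⊗-comm f h n)))

⊗-assoc : ∀ f g h → (f ⊗ g) ⊗ h ≗ f ⊗ (g ⊗ h)
⊗-assoc f g h zero = *-assoc (f 0) (g 0) (h 0)
⊗-assoc f g h (suc n) = begin
  ((δ f ⊗ g ⊕ f ⊗ δ g) ⊗ h) n + (f ⊗ g ⊗ δ h) n
    ≡⟨ cong (_+ (f ⊗ g ⊗ δ h) n) (⊗-distribʳ h (δ f ⊗ g) (f ⊗ δ g) n) ⟩
  (δ f ⊗ g ⊗ h) n + (f ⊗ δ g ⊗ h) n + (f ⊗ g ⊗ δ h) n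
    ≡⟨ cong₂ _+_ (cong₂ _+_ (⊗-assoc (δ f) g h n) (⊗-assoc f (δ g) h n)) (⊗-assoc f g (δ h) n) ⟩
  (δ f ⊗ (g ⊗ h)) n + (f ⊗ (δ g ⊗ h)) n + (f ⊗ (g ⊗ δ h)) n
    ≡⟨ +-assoc ((δ f ⊗ (g ⊗ h)) n) _ _ ⟩
  (δ f ⊗ (g ⊗ h)) n + ((f ⊗ (δ g ⊗ h)) n + (f ⊗ (g ⊗ δ h)) n)
    ≡⟨ cong ((δ f ⊗ (g ⊗ h)) n +_) (sym (⊗-distribˡ f (δ g ⊗ h) (g ⊗ δ h) n)) ⟩
  (δ f ⊗ (g ⊗ h)) n + (f ⊗ δ (g ⊗ h)) n ∎
  where open ≡-Reasoning

⊗-comm-assoc : ∀ f g h → f ⊗ (g ⊗ h) ≗ g ⊗ (f ⊗ h)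
⊗-comm-assoc f g h n = trans (sym (⊗-assoc f g h n))
  (trans (⊗-congʳ h (⊗-comm f g) n) (⊗-assoc g f h n))

·-⊗ : ∀ c f g → (c · f) ⊗ g ≗ c · (f ⊗ g)
·-⊗ c f g zero = *-assoc c (f 0) (g 0)
·-⊗ c f g (suc n) = trans (cong₂ _+_ (·-⊗ c (δ f) g n) (·-⊗ c f (δ g) n))
  (sym (*-distribˡ-+ c ((δ f ⊗ g) n) _))

⊗-· : ∀ c f g → f ⊗ (c · g) ≗ c · (f ⊗ g)
⊗-· c f g n = trans (⊗-comm f (c · g) n)
  (trans (·-⊗ c g f n) (cong (c *_) (⊗-comm g f n)))

⊗-zeroˡ : ∀ f → 0# ⊗ f ≗ 0#
⊗-zeroˡ f zero = refl
⊗-zeroˡ f (suc n) = cong₂ _+_ (⊗-zeroˡ f n) (⊗-zeroˡ (δ f) n)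

⊗-zeroʳ : ∀ f → f ⊗ 0# ≗ 0#
⊗-zeroʳ f n = trans (⊗-comm f 0# n) (⊗-zeroˡ f n)

-- The exponential tail Σ_{n ≥ m} xⁿ/n!, and eˣ itself for m = 0.
tail≥ : ℕ → Seq
tail≥ zero n = 1
tail≥ (suc m) zero = 0
tail≥ (suc m) (suc n) = tail≥ m n

-- The truncated exponential Σ_{n < m} xⁿ/n!.
head< : ℕ → Seq
head< zero n = 0
head< (suc m) zero = 1
head< (suc m) (suc n) = head< m n

exp one : Seq
exp = tail≥ 0
one = head< 1

head⊕tail : ∀ m → exp ≗ head< m ⊕ tail≥ m
head⊕tail zero n = refl
head⊕tail (suc m) zero = refl
head⊕tail (suc m) (suc n) = head⊕tail m n

head≼exp : ∀ m → head< m ≼ exp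
head≼exp m n = subst (head< m n ≤_) (sym (head⊕tail m n)) (m≤m+n _ _)

tail≼exp : ∀ m → tail≥ m ≼ exp
tail≼exp m n = subst (tail≥ m n ≤_) (sym (head⊕tail m n)) (m≤n+m _ _)

⊗-identityˡ : ∀ f → one ⊗ f ≗ f
⊗-identityˡ f zero = *-identityˡ (f 0)
⊗-identityˡ f (suc n) = cong₂ _+_ (⊗-zeroˡ f n) (⊗-identityˡ (δ f) n)

⊗-identityʳ : ∀ f → f ⊗ one ≗ f
⊗-identityʳ f n = trans (⊗-comm f one n) (⊗-identityˡ f n)

-- With γ the antiderivative of g vanishing at 0, power-term g j = γʲ/j!
-- and exp-trunc g d = Σ_{j ≤ d} γʲ/j!.
power-term : Seq → ℕ → Seq
power-term g zero = one
power-term g (suc j) zero = 0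
power-term g (suc j) (suc n) = (g ⊗ power-term g j) n

exp-trunc : Seq → ℕ → Seq
exp-trunc g zero = one
exp-trunc g (suc d) zero = 1
exp-trunc g (suc d) (suc n) = (g ⊗ exp-trunc g d) n

exp-trunc-mono : ∀ {g h} d → g ≼ h → exp-trunc g d ≼ exp-trunc h d
exp-trunc-mono zero g≼h n = ≤-refl
exp-trunc-mono (suc d) g≼h zero = ≤-refl
exp-trunc-mono (suc d) g≼h (suc n) = ⊗-mono g≼h (exp-trunc-mono d g≼h) n

exp-trunc-0 : ∀ g d → exp-trunc g d 0 ≡ 1
exp-trunc-0 g zero = refl
exp-trunc-0 g (suc d) = refl

exp-trunc-suc : ∀ g d → exp-trunc g (suc d) ≗ exp-trunc g d ⊕ power-term g (suc d)
exp-trunc-suc g d zero = cong (_+ 0) (sym (exp-trunc-0 g d))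
exp-trunc-suc g zero (suc n) = refl
exp-trunc-suc g (suc d) (suc n) = trans
  (⊗-congˡ g (exp-trunc-suc g d) n)
  (⊗-distribˡ g (exp-trunc g d) (power-term g (suc d)) n)

Σ< : ℕ → (ℕ → Seq) → Seq
Σ< zero F = 0#
Σ< (suc m) F = F 0 ⊕ Σ< m (λ j → F (suc j))

⊗-Σ< : ∀ f m F → f ⊗ Σ< m F ≗ Σ< m (λ j → f ⊗ F j)
⊗-Σ< f zero F n = ⊗-zeroʳ f n
⊗-Σ< f (suc m) F n = trans (⊗-distribˡ f (F 0) (Σ< m (λ j → F (suc j))) n)
  (cong (_ +_) (⊗-Σ< f m (λ j → F (suc j)) n))

Σ<-mono : ∀ m {F H : ℕ → Seq} → (∀ j → j < m → F j ≼ H j) → Σ< m F ≼ Σ< m H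
Σ<-mono zero p n = z≤n
Σ<-mono (suc m) p n = +-mono-≤ (p 0 z<s n) (Σ<-mono m (λ j j<m → p (suc j) (s<s j<m)) n)

Σ<-0 : ∀ m F → (∀ j → F j 0 ≡ 0) → Σ< m F 0 ≡ 0
Σ<-0 zero F p = refl
Σ<-0 (suc m) F p = cong₂ _+_ (p 0) (Σ<-0 m (λ j → F (suc j)) (λ j → p (suc j)))

δ-Σ< : ∀ m F n → Σ< m F (suc n) ≡ Σ< m (λ j → δ (F j)) n
δ-Σ< zero F n = refl
δ-Σ< (suc m) F n = cong (_ +_) (δ-Σ< m (λ j → F (suc j)) n)

exp-trunc-Σ : ∀ g d → exp-trunc g d ≗ Σ< (suc d) (power-term g)
exp-trunc-Σ g zero n = sym (+-identityʳ _)
exp-trunc-Σ g (suc d) zero =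
  cong suc (sym (Σ<-0 (suc d) (λ j → power-term g (suc j)) (λ _ → refl)))
exp-trunc-Σ g (suc d) (suc n) = begin
  (g ⊗ exp-trunc g d) n                             ≡⟨ ⊗-congˡ g (exp-trunc-Σ g d) n ⟩
  (g ⊗ Σ< (suc d) (power-term g)) n                 ≡⟨ ⊗-Σ< g (suc d) (power-term g) n ⟩
  Σ< (suc d) (λ j → g ⊗ power-term g j) n
    ≡⟨ δ-Σ< (suc d) (λ j → power-term g (suc j)) n ⟨
  Σ< (suc d) (λ j → power-term g (suc j)) (suc n)   ∎
  where open ≡-Reasoning

-- Here γ = x. This lets `head<` be expanded over the same index `j` as `exp-trunc exp`.
exp-trunc-one : ∀ d → exp-trunc one d ≗ head< (suc d)
exp-trunc-one zero n = refl
exp-trunc-one (suc d) zero = refl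
exp-trunc-one (suc d) (suc n) = trans (⊗-identityˡ (exp-trunc one d) n) (exp-trunc-one d n)

-- Powers of x and of eˣ - 1, and the termwise inequality

infixr 8 _^⊗_
_^⊗_ : Seq → ℕ → Seq
f ^⊗ zero = one
f ^⊗ suc j = f ⊗ f ^⊗ j

δ-^⊗ : ∀ f j → δ (f ^⊗ suc j) ≗ suc j · (δ f ⊗ f ^⊗ j)
δ-^⊗ f zero n = begin
  (δ f ⊗ one) n + (f ⊗ 0#) n  ≡⟨ cong ((δ f ⊗ one) n +_) (⊗-zeroʳ f n) ⟩
  (δ f ⊗ one) n + 0           ∎
  where open ≡-Reasoning
δ-^⊗ f (suc j) n = cong ((δ f ⊗ f ^⊗ suc j) n +_) (begin
  (f ⊗ δ (f ^⊗ suc j)) n                ≡⟨ ⊗-congˡ f (δ-^⊗ f j) n ⟩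
  (f ⊗ (suc j · (δ f ⊗ f ^⊗ j))) n      ≡⟨ ⊗-· (suc j) f (δ f ⊗ f ^⊗ j) n ⟩
  suc j * (f ⊗ (δ f ⊗ f ^⊗ j)) n        ≡⟨ cong (suc j *_) (⊗-comm-assoc f (δ f) (f ^⊗ j) n) ⟩
  suc j * (δ f ⊗ f ^⊗ suc j) n          ∎)
  where open ≡-Reasoning

-- Both sides agree at 0 because `f 0 ≡ 0`, and their derivatives agree by (fʲ⁺¹)′ = (j+1) f′ fʲ.
-- Clearing denominators turns the termwise comparison into one of plain powers.
!·power-term : ∀ f j → f 0 ≡ 0 → j ! · power-term (δ f) j ≗ f ^⊗ j
!·power-term f zero f0 n = +-identityʳ _
!·power-term f (suc j) f0 zero =
  trans (*-zeroʳ (suc j !)) (cong (_* (f ^⊗ j) 0) (sym f0))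
!·power-term f (suc j) f0 (suc n) = begin
  (suc j * j !) * (δ f ⊗ power-term (δ f) j) n   ≡⟨ *-assoc (suc j) (j !) _ ⟩
  suc j * (j ! * (δ f ⊗ power-term (δ f) j) n)   ≡⟨ cong (suc j *_) (⊗-· (j !) (δ f) (power-term (δ f) j) n) ⟨
  suc j * (δ f ⊗ (j ! · power-term (δ f) j)) n
    ≡⟨ cong (suc j *_) (⊗-congˡ (δ f) (!·power-term f j f0) n) ⟩
  suc j * (δ f ⊗ f ^⊗ j) n                       ≡⟨ δ-^⊗ f j n ⟨
  (f ^⊗ suc j) (suc n)                           ∎
  where open ≡-Reasoning

x eˣ-1 : Seq
x zero = 0
x (suc n) = one n
eˣ-1 = tail≥ 1

x≼eˣ-1 : x ≼ eˣ-1
x≼eˣ-1 zero = z≤n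
x≼eˣ-1 (suc n) = head≼exp 1 n

eˣ-1≼xeˣ : eˣ-1 ≼ x ⊗ exp
eˣ-1≼xeˣ zero = z≤n
eˣ-1≼xeˣ (suc n) =
  subst (1 ≤_) (cong (_+ (x ⊗ exp) n) (sym (⊗-identityˡ exp n))) (s≤s z≤n)

-- Compare derivatives, with u = eˣ - 1. By induction the left one is at most m+2 copies of xᵐu; m+1
-- of them form (xᵐ⁺¹)′u, and the last is at most xᵐ⁺¹eˣ because u ≤ xeˣ. These are the two Leibniz
-- terms on the right.
!·tail≼ : ∀ m → (suc m) ! · tail≥ (suc m) ≼ x ^⊗ m ⊗ eˣ-1
!·tail≼ zero n = ≤-reflexive (trans (*-identityˡ _) (sym (⊗-identityˡ eˣ-1 n)))
!·tail≼ (suc m) zero = subst (_≤ 0) (sym (*-zeroʳ (suc (suc m) !))) z≤n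
!·tail≼ (suc m) (suc n) = begin
  (suc (suc m) * (suc m) !) * tail≥ (suc m) n
    ≡⟨ *-assoc (suc (suc m)) ((suc m) !) (tail≥ (suc m) n) ⟩
  suc (suc m) * ((suc m) ! * tail≥ (suc m) n)
    ≤⟨ *-monoʳ-≤ (suc (suc m)) (!·tail≼ m n) ⟩
  (x ^⊗ m ⊗ eˣ-1) n + suc m * (x ^⊗ m ⊗ eˣ-1) n
    ≡⟨ +-comm ((x ^⊗ m ⊗ eˣ-1) n) _ ⟩
  suc m * (x ^⊗ m ⊗ eˣ-1) n + (x ^⊗ m ⊗ eˣ-1) n
    ≤⟨ +-mono-≤ (≤-reflexive derivative) (⊗-mono {x ^⊗ m} (λ _ → ≤-refl) eˣ-1≼xeˣ n) ⟩
  (δ (x ^⊗ suc m) ⊗ eˣ-1) n + (x ^⊗ m ⊗ (x ⊗ exp)) n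
    ≡⟨ cong ((δ (x ^⊗ suc m) ⊗ eˣ-1) n +_) (trans (⊗-comm-assoc (x ^⊗ m) x exp n) (sym (⊗-assoc x (x ^⊗ m) exp n))) ⟩
  (δ (x ^⊗ suc m) ⊗ eˣ-1) n + (x ^⊗ suc m ⊗ exp) n ∎
  where
  open ≤-Reasoning
  δxᵐ⁺¹ : suc m · x ^⊗ m ≗ δ (x ^⊗ suc m)
  δxᵐ⁺¹ i = sym (trans (δ-^⊗ x m i) (cong (suc m *_) (⊗-identityˡ (x ^⊗ m) i)))
  derivative : suc m * (x ^⊗ m ⊗ eˣ-1) n ≡ (δ (x ^⊗ suc m) ⊗ eˣ-1) n
  derivative = trans (sym (·-⊗ (suc m) (x ^⊗ m) eˣ-1 n)) (⊗-congʳ eˣ-1 δxᵐ⁺¹ n)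

-- Trades the `d` surplus factors `f` for `g`, one at a time. Exponents written as sums keep
-- subtraction out of the induction; `tail⊗term≼` takes `d = M ∸ j` and `b = j`.
^⊗-exchange : ∀ {f g} d b → f ≼ g →
  f ^⊗ (d + b) ⊗ g ^⊗ suc b ≼ f ^⊗ b ⊗ g ^⊗ suc (d + b)
^⊗-exchange zero b f≼g n = ≤-refl
^⊗-exchange {f} {g} (suc d) b f≼g n = begin
  (f ^⊗ suc (d + b) ⊗ g ^⊗ suc b) n          ≡⟨ ⊗-assoc f (f ^⊗ (d + b)) (g ^⊗ suc b) n ⟩
  (f ⊗ (f ^⊗ (d + b) ⊗ g ^⊗ suc b)) n        ≤⟨ ⊗-mono f≼g (^⊗-exchange d b f≼g) n ⟩
  (g ⊗ (f ^⊗ b ⊗ g ^⊗ suc (d + b))) n        ≡⟨ ⊗-comm-assoc g (f ^⊗ b) (g ^⊗ suc (d + b)) n ⟩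
  (f ^⊗ b ⊗ g ^⊗ suc (suc d + b)) n          ∎
  where open ≤-Reasoning

·-⊗-· : ∀ c d f g → (c · f) ⊗ (d · g) ≗ (c * d) · (f ⊗ g)
·-⊗-· c d f g n = trans (·-⊗ c f (d · g) n)
  (trans (cong (c *_) (⊗-· d f g n)) (sym (*-assoc c d _)))

tail⊗term≼ : ∀ M j → j ≤ M →
  tail≥ (suc M) ⊗ power-term exp j ≼ power-term exp (suc M) ⊗ power-term one j
tail⊗term≼ M j j≤M n = *-cancelˡ-≤ (suc M ! * j !) {{suc M !* j !≢0}} (begin
  (suc M ! * j !) * (tail≥ (suc M) ⊗ power-term exp j) n
    ≡⟨ ·-⊗-· (suc M !) (j !) (tail≥ (suc M)) (power-term exp j) n ⟨
  ((suc M ! · tail≥ (suc M)) ⊗ (j ! · power-term exp j)) n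
    ≤⟨ ⊗-mono (!·tail≼ M) (λ i → ≤-reflexive (!·power-term eˣ-1 j refl i)) n ⟩
  (x ^⊗ M ⊗ eˣ-1 ⊗ eˣ-1 ^⊗ j) n
    ≡⟨ ⊗-assoc (x ^⊗ M) eˣ-1 (eˣ-1 ^⊗ j) n ⟩
  (x ^⊗ M ⊗ eˣ-1 ^⊗ suc j) n
    ≤⟨ subst (λ N → x ^⊗ N ⊗ eˣ-1 ^⊗ suc j ≼ x ^⊗ j ⊗ eˣ-1 ^⊗ suc N) (m∸n+n≡m j≤M)
         (^⊗-exchange (M ∸ j) j x≼eˣ-1) n ⟩
  (x ^⊗ j ⊗ eˣ-1 ^⊗ suc M) n
    ≡⟨ ⊗-comm (x ^⊗ j) (eˣ-1 ^⊗ suc M) n ⟩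
  (eˣ-1 ^⊗ suc M ⊗ x ^⊗ j) n
    ≡⟨ ⊗-cong (!·power-term eˣ-1 (suc M) refl) (!·power-term x j refl) n ⟨
  ((suc M ! · power-term exp (suc M)) ⊗ (j ! · power-term one j)) n
    ≡⟨ ·-⊗-· (suc M !) (j !) (power-term exp (suc M)) (power-term one j) n ⟩
  (suc M ! * j !) * (power-term exp (suc M) ⊗ power-term one j) n ∎)
  where open ≤-Reasoning

≤exp⊗ : ∀ f → f ≼ exp ⊗ f
≤exp⊗ f n = subst (_≤ (exp ⊗ f) n) (⊗-identityˡ f n)
  (⊗-mono (head≼exp 1) (λ _ → ≤-refl) n)

stirling≥1 : ∀ j n → j ≤ n → 1 ≤ power-term exp (suc j) (suc n)
stirling≥1 zero n _ = ≤-reflexive (sym (⊗-identityʳ exp n))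
stirling≥1 (suc j) (suc n) (s≤s j≤n) =
  ≤-trans (stirling≥1 j n j≤n) (≤exp⊗ (power-term exp (suc j)) (suc n))

-- `power-term exp j n` is the Stirling number S(n, j). As `δ exp` is `exp`, the Leibniz rule yields
-- two summands, each bounded below by a positive Stirling number. For `j = n` the value would be 1.
stirling≥2 : ∀ j n → j < n → 2 ≤ power-term exp (suc (suc j)) (suc (suc n))
stirling≥2 j (suc n) (s≤s j≤n) = +-mono-≤
  (≤-trans (stirling≥1 j n j≤n) (≤exp⊗ (power-term exp (suc j)) (suc n)))
  (≤-trans (stirling≥1 j (suc n) (m≤n⇒m≤1+n j≤n)) (≤exp⊗ (δ (power-term exp (suc j))) (suc n)))

-- The inequality between the derivatives, with m = M + 1

module _ (M : ℕ) where

  private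
    lhs rhs : ℕ → Seq
    lhs j = tail≥ (suc M) ⊗ power-term exp j
    rhs j = power-term exp (suc M) ⊗ power-term one j

  tail⊗bell≡Σ : tail≥ (suc M) ⊗ exp-trunc exp M ≗ Σ< (suc M) lhs
  tail⊗bell≡Σ n = trans (⊗-congˡ (tail≥ (suc M)) (exp-trunc-Σ exp M) n)
    (⊗-Σ< (tail≥ (suc M)) (suc M) (power-term exp) n)

  head⊗stirling≡Σ : head< (suc M) ⊗ power-term exp (suc M) ≗ Σ< (suc M) rhs
  head⊗stirling≡Σ n = begin
    (head< (suc M) ⊗ power-term exp (suc M)) n
      ≡⟨ ⊗-comm (head< (suc M)) (power-term exp (suc M)) n ⟩
    (power-term exp (suc M) ⊗ head< (suc M)) n
      ≡⟨ ⊗-congˡ (power-term exp (suc M))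
           (λ i → trans (sym (exp-trunc-one M i)) (exp-trunc-Σ one M i)) n ⟩
    (power-term exp (suc M) ⊗ Σ< (suc M) (power-term one)) n
      ≡⟨ ⊗-Σ< (power-term exp (suc M)) (suc M) (power-term one) n ⟩
    Σ< (suc M) rhs n ∎
    where open ≡-Reasoning

  exp⊗bell : ∀ n → (exp ⊗ exp-trunc exp M) n ≡
    (head< (suc M) ⊗ exp-trunc exp M) n + Σ< (suc M) lhs n
  exp⊗bell n = trans (⊗-congʳ (exp-trunc exp M) (head⊕tail (suc M)) n)
    (trans (⊗-distribʳ (exp-trunc exp M) (head< (suc M)) (tail≥ (suc M)) n)
           (cong ((head< (suc M) ⊗ exp-trunc exp M) n +_) (tail⊗bell≡Σ n)))

  head⊗bell : ∀ n → (head< (suc M) ⊗ exp-trunc exp (suc M)) n ≡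
    (head< (suc M) ⊗ exp-trunc exp M) n + Σ< (suc M) rhs n
  head⊗bell n = trans (⊗-congˡ (head< (suc M)) (exp-trunc-suc exp M) n)
    (trans (⊗-distribˡ (head< (suc M)) (exp-trunc exp M) (power-term exp (suc M)) n)
           (cong ((head< (suc M) ⊗ exp-trunc exp M) n +_) (head⊗stirling≡Σ n)))

  δbell≼ : exp ⊗ exp-trunc exp M ≼ head< (suc M) ⊗ exp-trunc exp (suc M)
  δbell≼ n rewrite exp⊗bell n | head⊗bell n =
    +-monoʳ-≤ ((head< (suc M) ⊗ exp-trunc exp M) n)
      (Σ<-mono (suc M) {lhs} {rhs} (λ { j (s≤s j≤M) → tail⊗term≼ M j j≤M }) n)

  -- The terms with j = 0 are 1 and the Stirling number S(n, M + 1) ≥ 2.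
  δbell< : 1 ≤ M → ∀ n → suc M < n →
    (exp ⊗ exp-trunc exp M) n < (head< (suc M) ⊗ exp-trunc exp (suc M)) n
  δbell< (s≤s {n = M′} z≤n) n@(suc (suc n′)) (s≤s (s≤s M′<n′)) rewrite exp⊗bell n | head⊗bell n =
    +-monoʳ-< ((head< (suc M) ⊗ exp-trunc exp M) n)
      (+-mono-<-≤ first
        (Σ<-mono M {λ j → lhs (suc j)} {λ j → rhs (suc j)} (λ j j<M → tail⊗term≼ M (suc j) j<M) n))
    where
    open ≤-Reasoning
    first : lhs 0 n < rhs 0 n
    first = begin-strict
      lhs 0 n                        ≡⟨ ⊗-identityʳ (tail≥ (suc M)) n ⟩
      tail≥ (suc M) n                ≤⟨ tail≼exp (suc M) n ⟩
      1                              <⟨ stirling≥2 M′ n′ M′<n′ ⟩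
      power-term exp (suc M) n       ≡⟨ ⊗-identityʳ (power-term exp (suc M)) n ⟨
      rhs 0 n                        ∎

  -- With h = `head< (suc M)`, the left series satisfies G′ ≤ hG by `δbell≼`, the right one B′ = hB
  -- up to truncation, and both start with 1. Each differentiation uses up one level of `D`, so
  -- degrees up to `D` are safe.
  bell≤ : ∀ D i → i ≤ D → exp-trunc exp (suc M) i ≤ exp-trunc (head< (suc M)) D i
  bell≤ zero zero _ = ≤-refl
  bell≤ (suc D) zero _ = ≤-refl
  bell≤ (suc D) (suc i) (s≤s i≤D) = ≤-trans (δbell≼ i)
    (⊗-mono-upto i (λ _ _ → ≤-refl) (λ j j≤i → bell≤ D j (≤-trans j≤i i≤D)))

  -- Strictness is needed only in the outermost differentiation; below it `bell≤` suffices.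
  bell< : 1 ≤ M → ∀ n → suc (suc M) < n →
    exp-trunc exp (suc M) n < exp-trunc (head< (suc M)) n n
  bell< 1≤M (suc n) (s≤s M<n) = <-≤-trans (δbell< 1≤M n M<n)
    (⊗-mono-upto n (λ _ _ → ≤-refl) (λ j j≤n → bell≤ n j j≤n))

-- Products of many factors

sum-filter : ∀ {A : Set} {p} {P : A → Set p} (P? : Decidable P) {f : A → ℕ} {ys} →
  All (λ y → ¬ P y → f y ≡ 0) ys → sum (map f (filter P? ys)) ≡ sum (map f ys)
sum-filter P? [] = refl
sum-filter P? {f} {y ∷ ys} (z ∷ zs) with P? y
... | yes _ = cong (f y +_) (sum-filter P? zs)
... | no ¬p = trans (sum-filter P? zs) (cong (_+ sum (map f ys)) (sym (z ¬p)))

sum-concatMap : ∀ {A B : Set} (f : B → ℕ) (g : A → List B) xs →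
  sum (map f (concatMap g xs)) ≡ sum (map (λ y → sum (map f (g y))) xs)
sum-concatMap f g [] = refl
sum-concatMap f g (y ∷ xs) = begin
  sum (map f (g y ++ concatMap g xs))                ≡⟨ cong sum (map-++ f (g y) _) ⟩
  sum (map f (g y) ++ map f (concatMap g xs))        ≡⟨ sum-++ (map f (g y)) _ ⟩
  sum (map f (g y)) + sum (map f (concatMap g xs))
    ≡⟨ cong (sum (map f (g y)) +_) (sum-concatMap f g xs) ⟩
  sum (map f (g y)) + sum (map (λ y′ → sum (map f (g y′))) xs) ∎
  where open ≡-Reasoning

sum-ones : ∀ {A : Set} {f : A → ℕ} {xs} → All (λ y → f y ≡ 1) xs → sum (map f xs) ≡ length xs
sum-ones [] = refl
sum-ones (p ∷ ps) = cong₂ _+_ p (sum-ones ps)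

⊗-sum : ∀ f (F : ℕ → Seq) ys n →
  (f ⊗ (λ i → sum (map (λ y → F y i) ys))) n ≡ sum (map (λ y → (f ⊗ F y) n) ys)
⊗-sum f F [] n = ⊗-zeroʳ f n
⊗-sum f F (y ∷ ys) n = trans (⊗-distribˡ f (F y) (λ i → sum (map (λ z → F z i) ys)) n)
  (cong ((f ⊗ F y) n +_) (⊗-sum f F ys n))

∏ : ℕ → (ℕ → Seq) → Seq → Seq
∏ zero g b = b
∏ (suc r) g b = g r ⊗ ∏ r g b

∏-cong : ∀ r {g h : ℕ → Seq} {b c} → (∀ z → z < r → g z ≗ h z) → b ≗ c → ∏ r g b ≗ ∏ r h c
∏-cong zero p q = q
∏-cong (suc r) p q = ⊗-cong (p r ≤-refl) (∏-cong r (λ z z<r → p z (m≤n⇒m≤1+n z<r)) q)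

∏-⊗ : ∀ r g f b → ∏ r g (f ⊗ b) ≗ f ⊗ ∏ r g b
∏-⊗ zero g f b n = refl
∏-⊗ (suc r) g f b n = trans (⊗-congˡ (g r) (∏-⊗ r g f b) n) (⊗-comm-assoc (g r) f (∏ r g b) n)

∏-0 : ∀ r {g : ℕ → Seq} {b : Seq} → (∀ z → g z 0 ≡ 1) → b 0 ≡ 1 → ∏ r g b 0 ≡ 1
∏-0 zero p q = q
∏-0 (suc r) p q = cong₂ _*_ (p r) (∏-0 r p q)

∏-zero-base : ∀ r g {b} → b ≗ 0# → ∏ r g b ≗ 0#
∏-zero-base zero g b≗0 = b≗0
∏-zero-base (suc r) g b≗0 n = trans (⊗-congˡ (g r) (∏-zero-base r g b≗0) n) (⊗-zeroʳ (g r) n)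

∏-zero : ∀ {r y} {g : ℕ → Seq} {b} → y < r → g y ≗ 0# → ∏ r g b ≗ 0#
∏-zero {suc r} {y} {g} {b} y<1+r gy≗0 n with y ≟ r
... | yes refl = trans (⊗-congʳ (∏ r g b) gy≗0 n) (⊗-zeroˡ (∏ r g b) n)
... | no y≢r = trans (⊗-congˡ (g r) (∏-zero (≤∧≢⇒< (≤-pred y<1+r) y≢r) gy≗0) n) (⊗-zeroʳ (g r) n)

-- The Leibniz rule; h y is g with its y-th factor differentiated.
δ-∏ : ∀ r g (h : ℕ → ℕ → Seq) b → (∀ y → y < r → h y y ≗ δ (g y)) →
  (∀ y z → z ≢ y → h y z ≗ g z) → ∀ n →
  ∏ r g b (suc n) ≡ sum (map (λ y → ∏ r (h y) b n) (downFrom r)) + ∏ r g (δ b) n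
δ-∏ zero g h b diag off n = refl
δ-∏ (suc r) g h b diag off n = begin
  (δ (g r) ⊗ ∏ r g b) n + (g r ⊗ δ (∏ r g b)) n
    ≡⟨ cong₂ _+_ first (⊗-congˡ (g r) (δ-∏ r g h b (λ y y<r → diag y (m≤n⇒m≤1+n y<r)) off) n) ⟩
  ∏ (suc r) (h r) b n + (g r ⊗ ((λ i → sum (map (λ y → ∏ r (h y) b i) (downFrom r))) ⊕ ∏ r g (δ b))) n
    ≡⟨ cong (∏ (suc r) (h r) b n +_)
         (trans (⊗-distribˡ (g r) (λ i → sum (map (λ y → ∏ r (h y) b i) (downFrom r))) (∏ r g (δ b)) n)
           (cong (_+ ∏ (suc r) g (δ b) n) rest)) ⟩
  ∏ (suc r) (h r) b n + (sum (map (λ y → ∏ (suc r) (h y) b n) (downFrom r)) + ∏ (suc r) g (δ b) n)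
    ≡⟨ +-assoc (∏ (suc r) (h r) b n) _ _ ⟨
  sum (map (λ y → ∏ (suc r) (h y) b n) (downFrom (suc r))) + ∏ (suc r) g (δ b) n ∎
  where
  open ≡-Reasoning
  first : (δ (g r) ⊗ ∏ r g b) n ≡ ∏ (suc r) (h r) b n
  first = ⊗-cong (λ i → sym (diag r ≤-refl i))
    (∏-cong r (λ z z<r i → sym (off r z (<⇒≢ z<r) i)) (λ _ → refl)) n
  rest : (g r ⊗ (λ i → sum (map (λ y → ∏ r (h y) b i) (downFrom r)))) n ≡
    sum (map (λ y → ∏ (suc r) (h y) b n) (downFrom r))
  rest = trans (⊗-sum (g r) (λ y → ∏ r (h y) b) (downFrom r) n)
    (cong sum (map-cong-local (All.tabulate λ {y} y∈ →
      ⊗-congʳ (∏ r (h y) b) (λ i → sym (off y r (≢-sym (<⇒≢ (∈-downFrom⁻ y∈))) i)) n)))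

-- Restricted growth words

-- One more than the largest letter; restricted growth skips no letter, so this is then the number
-- of blocks.
blocks : ∀ {n} → Vec ℕ n → ℕ
blocks [] = 0
blocks (y ∷ w) = suc y ⊔ blocks w

-- Read from the right; w encodes the partition of the
-- positions by equality of letters.
data RG : ∀ {n} → Vec ℕ n → Set where
  []  : RG []
  _∷_ : ∀ {n y} {w : Vec ℕ n} → y ≤ blocks w → RG w → RG (y ∷ w)

#_∈_ : ∀ {n} → ℕ → Vec ℕ n → ℕ
# y ∈ w = count (y ≟_) w

#-same : ∀ {n} y (w : Vec ℕ n) → # y ∈ (y ∷ w) ≡ suc (# y ∈ w)
#-same y w rewrite dec-true (y ≟ y) refl = refl

#-other : ∀ {n y z} (w : Vec ℕ n) → z ≢ y → # z ∈ (y ∷ w) ≡ # z ∈ w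
#-other {y = y} {z} w z≢y rewrite dec-false (z ≟ y) z≢y = refl

#-mono : ∀ {n} z y (w : Vec ℕ n) → # z ∈ w ≤ # z ∈ (y ∷ w)
#-mono z y w with does (z ≟ y)
... | true = n≤1+n _
... | false = ≤-refl

#≥blocks : ∀ {n z} (w : Vec ℕ n) → blocks w ≤ z → # z ∈ w ≡ 0
#≥blocks [] _ = refl
#≥blocks {z = z} (y ∷ w) le = trans
  (#-other w (λ z≡y → <-irrefl (sym z≡y) (≤-trans (m≤m⊔n (suc y) (blocks w)) le)))
  (#≥blocks w (≤-trans (m≤n⊔m (suc y) (blocks w)) le))

blocks-old : ∀ {n y} (w : Vec ℕ n) → y < blocks w → blocks (y ∷ w) ≡ blocks w
blocks-old w y<r = m≤n⇒m⊔n≡n y<r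

blocks-new : ∀ {n} (w : Vec ℕ n) → blocks (blocks w ∷ w) ≡ suc (blocks w)
blocks-new w = m≥n⇒m⊔n≡m (n≤1+n _)

blocks≤n : ∀ {n} {w : Vec ℕ n} → RG w → blocks w ≤ n
blocks≤n [] = z≤n
blocks≤n (y≤r ∷ rg) = ⊔-lub (s≤s (≤-trans y≤r (blocks≤n rg))) (m≤n⇒m≤1+n (blocks≤n rg))

-- Counting the words with at most `D` blocks of size at most `s`

module Enumeration (D s : ℕ) where

  Good : ∀ {n} → Vec ℕ n → Set
  Good w = RG w × blocks w ≤ D × (∀ z → # z ∈ w ≤ s)

  fits? : ∀ {n} (w : Vec ℕ n) → Decidable (λ y → y < D × # y ∈ w < s)
  fits? w y = y <? D ×-dec # y ∈ w <? s

  -- `downFrom` puts the fresh letter `blocks w` first, where `sum-children` splits it off, and then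
  -- runs through the old letters in the order in which `∏` unfolds.
  children : ∀ {n} → Vec ℕ n → List ℕ
  children w = filter (fits? w) (downFrom (suc (blocks w)))

  extend : ∀ {n} → Vec ℕ n → List (Vec ℕ (suc n))
  extend w = map (_∷ w) (children w)

  words : ∀ n → List (Vec ℕ n)
  words zero = [] ∷ []
  words (suc n) = concatMap extend (words n)

  good-extend : ∀ {n y} {w : Vec ℕ n} → Good w → y ∈ children w → Good (y ∷ w)
  good-extend {y = y} {w} (rg , r≤D , #≤s) y∈ with ∈-filter⁻ (fits? w) {xs = downFrom (suc (blocks w))} y∈
  ... | y∈down , y<D , #<s =
    ≤-pred (∈-downFrom⁻ y∈down) ∷ rg , ⊔-lub y<D r≤D , #≤s′
    where
    #≤s′ : ∀ z → # z ∈ (y ∷ w) ≤ s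
    #≤s′ z with z ≟ y
    ... | yes refl = subst (_≤ s) (sym (#-same z w)) #<s
    ... | no z≢y = subst (_≤ s) (sym (#-other w z≢y)) (#≤s z)

  words-good : ∀ n → All Good (words n)
  words-good zero = ([] , z≤n , λ _ → z≤n) ∷ []
  words-good (suc n) = All.concat⁺ (All.map⁺ (All.map
    (λ {w} good → All.map⁺ (All.tabulate (good-extend good))) (words-good n)))

  good⇒∈words : ∀ {n} {w : Vec ℕ n} → Good w → w ∈ words n
  good⇒∈words {w = []} _ = here refl
  good⇒∈words {w = y ∷ w} (y≤r ∷ rg , r≤D , #≤s) =
    ∈-concatMap⁺ extend (Any.map (λ { refl → ∈-map⁺ (_∷ w) y∈children })
      (good⇒∈words (rg , m⊔n≤o⇒n≤o (suc y) (blocks w) r≤D , λ z → ≤-trans (#-mono z y w) (#≤s z))))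
    where
    y∈children : y ∈ children w
    y∈children = ∈-filter⁺ (fits? w) (∈-downFrom⁺ (s≤s y≤r))
      (m⊔n≤o⇒m≤o (suc y) (blocks w) r≤D , subst (_≤ s) (#-same y w) (#≤s y))

  words-unique : ∀ n → Unique (words n)
  words-unique zero = [] ∷ []
  words-unique (suc n) = Unique.concat⁺
    (All.map⁺ (All.universal (λ w → Unique.map⁺ ∷-injectiveˡ
      (Unique.filter⁺ (fits? w) (Unique.downFrom⁺ (suc (blocks w))))) (words n)))
    (AllPairs.map⁺ (AllPairs.map disjoint (words-unique n)))
    where
    disjoint : ∀ {w w′ : Vec ℕ n} → w ≢ w′ → Disjoint (extend w) (extend w′)
    disjoint w≢w′ (v∈ , v∈′) with ∈-map⁻ _ v∈ | ∈-map⁻ _ v∈′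
    ... | _ , _ , refl | _ , _ , eq = w≢w′ (∷-injectiveʳ eq)

  -- room w z is the exponential generating function of the ways to add further
  -- positions to the block z, so completions w is that of all ways to continue w.
  room : ∀ {n} → Vec ℕ n → ℕ → Seq
  room w z = head< (suc s ∸ # z ∈ w)

  completions : ∀ {n} → Vec ℕ n → Seq
  completions w = ∏ (blocks w) (room w) (exp-trunc (head< s) (D ∸ blocks w))

  -- The word itself is its only completion of length 0. As no count exceeds `s`, every index
  -- `suc s ∸ # z ∈ w` is positive and every factor starts with 1.
  completions-0 : ∀ {n} {w : Vec ℕ n} → Good w → completions w 0 ≡ 1
  completions-0 {w = w} (_ , _ , #≤s) = ∏-0 (blocks w)
    (λ z → cong (λ k → head< k 0) (+-∸-assoc 1 (#≤s z))) (exp-trunc-0 (head< s) (D ∸ blocks w))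

  δ-room : ∀ {n} {w : Vec ℕ n} → Good w → ∀ y → room (y ∷ w) y ≗ δ (room w y)
  δ-room {w = w} (_ , _ , #≤s) y n = begin
    head< (suc s ∸ # y ∈ (y ∷ w)) n       ≡⟨ cong (λ c → head< (suc s ∸ c) n) (#-same y w) ⟩
    head< (s ∸ # y ∈ w) n                 ≡⟨ cong (λ k → head< k (suc n)) (+-∸-assoc 1 (#≤s y)) ⟨
    head< (suc s ∸ # y ∈ w) (suc n)       ∎
    where open ≡-Reasoning

  room-other : ∀ {n} (w : Vec ℕ n) {y z} → z ≢ y → room (y ∷ w) z ≗ room w z
  room-other w z≢y n = cong (λ c → head< (suc s ∸ c) n) (#-other w z≢y)

  join : ∀ {n} (w : Vec ℕ n) → ℕ → Seq
  join w y = ∏ (blocks w) (room (y ∷ w)) (exp-trunc (head< s) (D ∸ blocks w))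

  completions-old : ∀ {n} (w : Vec ℕ n) {y} → y < blocks w → completions (y ∷ w) ≗ join w y
  completions-old w {y} y<r n =
    cong (λ r → ∏ r (room (y ∷ w)) (exp-trunc (head< s) (D ∸ r)) n) (blocks-old w y<r)

  -- A full block has room `one`, whose derivative vanishes; so the Leibniz sum may run over all old
  -- letters while `children` keeps only those that fit.
  join-full : ∀ {n} {w : Vec ℕ n} {y} → Good w → y < blocks w →
    ¬ (y < D × # y ∈ w < s) → join w y ≗ 0#
  join-full {w = w} {y} (_ , r≤D , _) y<r ¬fits = ∏-zero {g = room (y ∷ w)} y<r λ n → begin
    head< (suc s ∸ # y ∈ (y ∷ w)) n       ≡⟨ cong (λ c → head< (suc s ∸ c) n) (#-same y w) ⟩
    head< (s ∸ # y ∈ w) n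
      ≡⟨ cong (λ k → head< k n) (m≤n⇒m∸n≡0 (≮⇒≥ (λ #<s → ¬fits (<-≤-trans y<r r≤D , #<s)))) ⟩
    0                                     ∎
    where open ≡-Reasoning

  newBlock : ∀ {n} → Vec ℕ n → Seq
  newBlock w = ∏ (blocks w) (room w) (δ (exp-trunc (head< s) (D ∸ blocks w)))

  -- Differentiating the truncated exponential uses up one available block and brings out `head< s`,
  -- the room of a block holding a single position.
  completions-new : ∀ {n} (w : Vec ℕ n) → blocks w < D →
    completions (blocks w ∷ w) ≗ newBlock w
  completions-new w r<D n = begin
    ∏ (blocks (r ∷ w)) (room (r ∷ w)) (G (D ∸ blocks (r ∷ w))) n
      ≡⟨ cong (λ r′ → ∏ r′ (room (r ∷ w)) (G (D ∸ r′)) n) (blocks-new w) ⟩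
    (room (r ∷ w) r ⊗ ∏ r (room (r ∷ w)) (G (D ∸ suc r))) n
      ≡⟨ ⊗-cong
           (λ i → cong (λ c → head< (suc s ∸ c) i)
             (trans (#-same r w) (cong suc (#≥blocks w ≤-refl))))
           (∏-cong r (λ z z<r → room-other w (<⇒≢ z<r)) (λ _ → refl)) n ⟩
    (head< s ⊗ ∏ r (room w) (G (D ∸ suc r))) n
      ≡⟨ ∏-⊗ r (room w) (head< s) (G (D ∸ suc r)) n ⟨
    ∏ r (room w) (head< s ⊗ G (D ∸ suc r)) n
      ≡⟨ ∏-cong r (λ _ _ _ → refl)
           (λ i → cong (λ d → G d (suc i)) (sym (+-∸-assoc 1 r<D))) n ⟩
    ∏ r (room w) (δ (G (D ∸ r))) n ∎
    where
    open ≡-Reasoning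
    r = blocks w
    G = exp-trunc (head< s)

  -- A fresh letter has count 0, so it fails to fit in only two ways: `D` blocks are already present
  -- and the truncation is constant, or `s = 0` and the factor `head< s` is zero.
  newBlock-full : ∀ {n} (w : Vec ℕ n) → ¬ (blocks w < D × # blocks w ∈ w < s) → newBlock w ≗ 0#
  newBlock-full w ¬fits = ∏-zero-base (blocks w) (room w) base
    where
    base : δ (exp-trunc (head< s) (D ∸ blocks w)) ≗ 0#
    base n with blocks w <? D
    ... | no r≮D = cong (λ d → exp-trunc (head< s) d (suc n)) (m≤n⇒m∸n≡0 (≮⇒≥ r≮D))
    ... | yes r<D = begin
      exp-trunc (head< s) (D ∸ blocks w) (suc n)
        ≡⟨ cong (λ d → exp-trunc (head< s) d (suc n)) (+-∸-assoc 1 r<D) ⟩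
      (head< s ⊗ exp-trunc (head< s) (D ∸ suc (blocks w))) n
        ≡⟨ cong (λ k → (head< k ⊗ exp-trunc (head< s) (D ∸ suc (blocks w))) n)
             (n≤0⇒n≡0 (subst (s ≤_) (#≥blocks w ≤-refl) (≮⇒≥ (λ #<s → ¬fits (r<D , #<s))))) ⟩
      (0# ⊗ exp-trunc (head< s) (D ∸ suc (blocks w))) n
        ≡⟨ ⊗-zeroˡ (exp-trunc (head< s) (D ∸ suc (blocks w))) n ⟩
      0 ∎
      where open ≡-Reasoning

  δ-completions : ∀ {n} {w : Vec ℕ n} → Good w → ∀ d →
    completions w (suc d) ≡ sum (map (λ y → join w y d) (downFrom (blocks w))) + newBlock w d
  δ-completions {w = w} good = δ-∏ (blocks w) (room w) (λ y → room (y ∷ w))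
    (exp-trunc (head< s) (D ∸ blocks w))
    (λ y _ → δ-room good y) (λ y z z≢y → room-other w z≢y)

  sum-old : ∀ {n} {w : Vec ℕ n} → Good w → ∀ d →
    sum (map (λ y → completions (y ∷ w) d) (filter (fits? w) (downFrom (blocks w))))
      ≡ sum (map (λ y → join w y d) (downFrom (blocks w)))
  sum-old {w = w} good d = trans
    (sum-filter (fits? w) (All.tabulate λ {y} y∈ ¬fits → let y<r = ∈-downFrom⁻ y∈ in
      trans (completions-old w y<r d) (join-full good y<r ¬fits d)))
    (cong sum (map-cong-local (All.tabulate λ y∈ → completions-old w (∈-downFrom⁻ y∈) d)))

  sum-children : ∀ {n} {w : Vec ℕ n} → Good w → ∀ d →
    sum (map (λ y → completions (y ∷ w) d) (children w)) ≡ completions w (suc d)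
  sum-children {w = w} good d with fits? w (blocks w)
  ... | yes fits rewrite filter-accept (fits? w) {xs = downFrom (blocks w)} fits =
    trans (cong₂ _+_ (completions-new w (proj₁ fits) d) (sum-old good d))
      (trans (+-comm (newBlock w d) _) (sym (δ-completions good d)))
  ... | no ¬fits rewrite filter-reject (fits? w) {xs = downFrom (blocks w)} ¬fits =
    trans (sum-old good d) (trans (sym (+-identityʳ _))
      (trans (cong (sum (map (λ y → join w y d) (downFrom (blocks w))) +_) (sym (newBlock-full w ¬fits d))) (sym (δ-completions good d))))

  -- The total depends on `n + d` only, since one more letter costs one derivative. At `n = 0` it is
  -- the series of the empty word; at `d = 0` every word contributes 1, which gives `length-words`.
  sum-words : ∀ n d → sum (map (λ w → completions w d) (words n)) ≡ completions [] (n + d)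
  sum-words zero d = +-identityʳ _
  sum-words (suc n) d = begin
    sum (map Φ (concatMap extend (words n)))
      ≡⟨ sum-concatMap Φ extend (words n) ⟩
    sum (map (λ w → sum (map Φ (extend w))) (words n))
      ≡⟨ cong sum (map-cong-local (All.map
           (λ {w} good → trans (cong sum (sym (map-∘ (children w)))) (sum-children good d))
           (words-good n))) ⟩
    sum (map (λ w → completions w (suc d)) (words n))
      ≡⟨ sum-words n (suc d) ⟩
    completions [] (n + suc d)
      ≡⟨ cong (completions []) (+-suc n d) ⟩
    completions [] (suc n + d) ∎
    where
    open ≡-Reasoning
    Φ : Vec ℕ (suc n) → ℕ
    Φ w = completions w d

  length-words : ∀ n → length (words n) ≡ exp-trunc (head< s) D n
  length-words n = begin
    length (words n)                                  ≡⟨ sum-ones (All.map completions-0 (words-good n)) ⟨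
    sum (map (λ w → completions w 0) (words n))       ≡⟨ sum-words n 0 ⟩
    completions [] (n + 0)                            ≡⟨ cong (completions []) (+-identityʳ n) ⟩
    exp-trunc (head< s) D n                           ∎
    where open ≡-Reasoning

-- Words and set partitions

lookup<blocks : ∀ {n} (w : Vec ℕ n) i → lookup w i < blocks w
lookup<blocks (y ∷ w) zero = m≤m⊔n (suc y) (blocks w)
lookup<blocks (y ∷ w) (suc i) = ≤-trans (lookup<blocks w i) (m≤n⊔m (suc y) (blocks w))

occurs : ∀ {n z} {w : Vec ℕ n} → RG w → z < blocks w → ∃ λ i → lookup w i ≡ z
occurs {z = z} {y ∷ w} (y≤r ∷ rg) z<r with y ≟ z | z <? blocks w
... | yes y≡z | _ = zero , y≡z
... | no _ | yes z<r′ = let i , eq = occurs rg z<r′ in suc i , eq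
... | no y≢z | no z≮r′ = contradiction z<r
  (≤⇒≯ (⊔-lub (≤∧≢⇒< (≤-trans y≤r (≮⇒≥ z≮r′)) y≢z) (≮⇒≥ z≮r′)))

SameKernel : ∀ {n} → Vec ℕ n → Vec ℕ n → Set
SameKernel w v = ∀ i j → lookup w i ≡ lookup w j → lookup v i ≡ lookup v j

-- The leading letter is forced: an old one is read off at a later position of the same block, and
-- otherwise it is `blocks w` in both words.
rg-unique : ∀ {n} {w v : Vec ℕ n} → RG w → RG v → SameKernel w v → SameKernel v w → w ≡ v
rg-unique [] [] _ _ = refl
rg-unique {w = y ∷ w} {z ∷ v} (y≤r ∷ rg) (z≤r ∷ rg′) w⇒v v⇒w
  with rg-unique rg rg′ (λ i j → w⇒v (suc i) (suc j)) (λ i j → v⇒w (suc i) (suc j))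
... | refl = cong (_∷ w) y≡z
  where
  y≡z : y ≡ z
  y≡z with y <? blocks w | z <? blocks w
  ... | yes y<r | _ = let i , eq = occurs rg y<r in trans (sym eq) (sym (w⇒v zero (suc i) (sym eq)))
  ... | no _ | yes z<r = let i , eq = occurs rg z<r in trans (v⇒w zero (suc i) (sym eq)) eq
  ... | no y≮r | no z≮r = trans (≤-antisym y≤r (≮⇒≥ y≮r)) (≤-antisym (≮⇒≥ z≮r) z≤r)

does⇒ : ∀ {p} {P : Set p} (P? : Dec P) → does P? ≡ true → P
does⇒ (yes p) _ = p

fromFunction : ∀ {n} → (Fin n → Fin n → Bool) → Rel n
fromFunction ρ = tabulate λ i → tabulate (ρ i)

∼-fromFunction : ∀ {n} (ρ : Fin n → Fin n → Bool) i j → i ∼[ fromFunction ρ ] j ≡ ρ i j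
∼-fromFunction ρ i j = trans
  (cong (λ row → lookup row j) (lookup∘tabulate (λ i → tabulate (ρ i)) i))
  (lookup∘tabulate (ρ i) j)

fromFunction-∼ : ∀ {n} (R : Rel n) → fromFunction (λ i j → i ∼[ R ] j) ≡ R
fromFunction-∼ R = trans (tabulate-cong (λ i → tabulate∘lookup (lookup R i))) (tabulate∘lookup R)

kernel : ∀ {n} → Vec ℕ n → Fin n → Fin n → Bool
kernel w i j = does (lookup w i ≟ lookup w j)

kernel⁺ : ∀ {n} (w : Vec ℕ n) {i j} → lookup w i ≡ lookup w j → i ∼[ fromFunction (kernel w) ] j ≡ true
kernel⁺ w {i} {j} eq = trans (∼-fromFunction (kernel w) i j) (dec-true (lookup w i ≟ lookup w j) eq)

kernel⁻ : ∀ {n} (w : Vec ℕ n) {i j} → i ∼[ fromFunction (kernel w) ] j ≡ true → lookup w i ≡ lookup w j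
kernel⁻ w {i} {j} p =
  does⇒ (lookup w i ≟ lookup w j) (trans (sym (∼-fromFunction (kernel w) i j)) p)

kernel-equiv : ∀ {n} (w : Vec ℕ n) → IsEquivalenceRel (fromFunction (kernel w))
kernel-equiv w = record
  { rfl = λ i → kernel⁺ w refl
  ; sym′ = λ i j p → kernel⁺ w (sym (kernel⁻ w p))
  ; trans′ = λ i j l p q → kernel⁺ w (trans (kernel⁻ w p) (kernel⁻ w q))
  }

partition : ∀ {n} → Vec ℕ n → SetPartition n
partition w = mkSP (fromFunction (kernel w)) (kernel-equiv w)

partition-injective : ∀ {n} {w v : Vec ℕ n} → RG w → RG v →
  rel (partition w) ≡ rel (partition v) → w ≡ v
partition-injective {w = w} {v} rg rg′ eq = rg-unique rg rg′
  (λ i j p → kernel⁻ v (subst (λ R → i ∼[ R ] j ≡ true) eq (kernel⁺ w p)))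
  (λ i j p → kernel⁻ w (subst (λ R → i ∼[ R ] j ≡ true) (sym eq) (kernel⁺ v p)))

-- With `ρ` a function instead of a matrix, restriction to the tail is composition with `suc`.
-- Position 0 copies the letter of an equivalent later position, or takes the fresh letter if there
-- is none.
encode : ∀ {n} (ρ : Fin n → Fin n → Bool) → (∀ i → ρ i i ≡ true) →
  (∀ i j → ρ i j ≡ true → ρ j i ≡ true) →
  (∀ i j l → ρ i j ≡ true → ρ j l ≡ true → ρ i l ≡ true) →
  ∃ λ w → RG w × (∀ i j → ρ i j ≡ kernel w i j)
encode {zero} ρ _ _ _ = [] , [] , λ ()
encode {suc n} ρ ρ-refl ρ-sym ρ-trans
  with encode (λ i j → ρ (suc i) (suc j)) (λ i → ρ-refl (suc i)) (λ i j → ρ-sym (suc i) (suc j))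
         (λ i j l → ρ-trans (suc i) (suc j) (suc l))
     | any? (λ j → ρ zero (suc j) Bool.≟ true)
... | w , rg , spec | yes (j , 0∼j) =
  lookup w j ∷ w , <⇒≤ (lookup<blocks w j) ∷ rg , spec′
  where
  spec′ : ∀ a b → ρ a b ≡ kernel (lookup w j ∷ w) a b
  spec′ zero zero = trans (ρ-refl zero) (sym (dec-true (lookup w j ≟ lookup w j) refl))
  spec′ zero (suc b) = trans
    (⇔→≡ (mk⇔ (ρ-trans _ _ _ (ρ-sym _ _ 0∼j)) (ρ-trans _ _ _ 0∼j))) (spec j b)
  spec′ (suc a) zero = trans
    (⇔→≡ (mk⇔ (λ p → ρ-trans _ _ _ p 0∼j) (λ p → ρ-trans _ _ _ p (ρ-sym _ _ 0∼j)))) (spec a j)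
  spec′ (suc a) (suc b) = spec a b
... | w , rg , spec | no 0≁ = blocks w ∷ w , ≤-refl ∷ rg , spec′
  where
  spec′ : ∀ a b → ρ a b ≡ kernel (blocks w ∷ w) a b
  spec′ zero zero = trans (ρ-refl zero) (sym (dec-true (blocks w ≟ blocks w) refl))
  spec′ zero (suc b) = trans (¬-not (λ p → 0≁ (b , p)))
    (sym (dec-false (blocks w ≟ lookup w b) (≢-sym (<⇒≢ (lookup<blocks w b)))))
  spec′ (suc a) zero = trans (¬-not (λ p → 0≁ (a , ρ-sym _ _ p)))
    (sym (dec-false (lookup w a ≟ blocks w) (<⇒≢ (lookup<blocks w a))))
  spec′ (suc a) (suc b) = spec a b

partition-surjective : ∀ {n} (R : Rel n) → IsEquivalenceRel R →
  ∃ λ w → RG w × R ≡ rel (partition w)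
partition-surjective R equiv =
  let open IsEquivalenceRel equiv
      w , rg , spec = encode (λ i j → i ∼[ R ] j) rfl sym′ trans′
  in w , rg , trans (sym (fromFunction-∼ R))
       (tabulate-cong (λ i → tabulate-cong (spec i)))

-- Pattern containment

Increasing : ∀ {k n} → (Fin k → Fin n) → Set
Increasing f = ∀ i j → i <ᶠ j → f i <ᶠ f j

prepend : ∀ {k n} → (Fin k → Fin n) → Fin (suc k) → Fin (suc n)
prepend f zero = zero
prepend f (suc i) = suc (f i)

prepend-increasing : ∀ {k n} {f : Fin k → Fin n} → Increasing f → Increasing (prepend f)
prepend-increasing inc zero (suc j) _ = z<s
prepend-increasing inc (suc i) (suc j) (s≤s i<j) = s<s (inc i j i<j)

suc-increasing : ∀ {k n} {f : Fin k → Fin n} → Increasing f → Increasing (λ i → suc (f i))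
suc-increasing inc i j i<j = s<s (inc i j i<j)

representatives : ∀ {k n} {w : Vec ℕ n} → RG w → k ≤ blocks w →
  Σ (Fin k → Fin n) λ f → Increasing f × (∀ i j → lookup w (f i) ≡ lookup w (f j) → i ≡ j)
representatives {zero} _ _ = (λ ()) , (λ ()) , λ ()
representatives {suc k} {w = y ∷ w} (y≤r ∷ rg) k<r with suc k ≤? blocks w
... | yes k<r′ = let f , inc , inj = representatives rg k<r′ in
  (λ i → suc (f i)) , suc-increasing inc , inj
-- The tail has at most `k` blocks, which forces `y` to be at least `k`; so `y` is fresh, and
-- position 0 supplies the missing representative.
... | no k≮r′ = prepend f , prepend-increasing inc , inj′
  where
  r≤k : blocks w ≤ k
  r≤k = ≮⇒≥ k≮r′
  k≤y : k ≤ y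
  k≤y = ≮⇒≥ (λ y<k → <-irrefl refl (≤-trans k<r (⊔-lub y<k r≤k)))
  rec = representatives rg (≤-trans k≤y y≤r)
  f = proj₁ rec
  inc = proj₁ (proj₂ rec)
  new : ∀ j → lookup w (f j) ≢ y
  new j = <⇒≢ (<-≤-trans (lookup<blocks w (f j)) (≤-trans r≤k k≤y))
  inj′ : ∀ i j → lookup (y ∷ w) (prepend f i) ≡ lookup (y ∷ w) (prepend f j) → i ≡ j
  inj′ zero zero _ = refl
  inj′ zero (suc j) eq = contradiction (sym eq) (new j)
  inj′ (suc i) zero eq = contradiction eq (new i)
  inj′ (suc i) (suc j) eq = cong suc (proj₂ (proj₂ rec) i j eq)

copies : ∀ {k n z} (w : Vec ℕ n) → k ≤ # z ∈ w →
  Σ (Fin k → Fin n) λ f → Increasing f × (∀ i → lookup w (f i) ≡ z)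
copies {zero} w _ = (λ ()) , (λ ()) , λ ()
copies {suc k} {z = z} (y ∷ w) le with z ≟ y
... | no z≢y = let f , inc , eq = copies w (subst (suc k ≤_) (#-other w z≢y) le) in
  (λ i → suc (f i)) , suc-increasing inc , eq
... | yes refl = let f , inc , eq = copies w (≤-pred (subst (suc k ≤_) (#-same z w) le)) in
  prepend f , prepend-increasing inc , λ { zero → refl ; (suc i) → eq i }

lower : ∀ {k n} (f : Fin k → Fin (suc n)) → (∀ i → zero {n} <ᶠ f i) →
  Σ (Fin k → Fin n) λ f′ → ∀ i → f i ≡ suc (f′ i)
lower f f>0 = (λ i → proj₁ (pred⁺ (f i) (f>0 i))) , λ i → proj₂ (pred⁺ (f i) (f>0 i))
  where
  pred⁺ : ∀ {n} (i : Fin (suc n)) → zero {n} <ᶠ i → ∃ λ j → i ≡ suc j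
  pred⁺ (suc j) _ = j , refl

-- An increasing `f` can reach position 0 only at its first argument. With that one set aside, all
-- values are positive and `lower` moves them into the tail.
copies-bound : ∀ {k n z} (w : Vec ℕ n) (f : Fin k → Fin n) → Increasing f →
  (∀ i → lookup w (f i) ≡ z) → k ≤ # z ∈ w
copies-bound {zero} w f _ _ = z≤n
copies-bound {suc k} [] f _ _ with () ← f zero
copies-bound {suc k} {suc n} {z} (y ∷ w) f inc eq with f zero in f0
... | zero = subst (suc k ≤_)
    (trans (sym (#-same y w)) (cong (λ v → # v ∈ (y ∷ w)) (trans (cong (lookup (y ∷ w)) (sym f0)) (eq zero))))
    (s≤s (subst (λ v → k ≤ # v ∈ w) (trans (sym (eq zero)) (cong (lookup (y ∷ w)) f0)) rest))
  where
  f′ = lower (λ i → f (suc i)) (λ i → subst (_<ᶠ f (suc i)) f0 (inc zero (suc i) z<s))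
  rest : k ≤ # z ∈ w
  rest = copies-bound w (proj₁ f′)
    (λ i j i<j → ≤-pred (subst₂ _<ᶠ_ (proj₂ f′ i) (proj₂ f′ j) (inc (suc i) (suc j) (s<s i<j))))
    (λ i → trans (cong (lookup (y ∷ w)) (sym (proj₂ f′ i))) (eq (suc i)))
... | suc l = ≤-trans (copies-bound w (proj₁ f′)
    (λ i j i<j → ≤-pred (subst₂ _<ᶠ_ (proj₂ f′ i) (proj₂ f′ j) (inc i j i<j)))
    (λ i → trans (cong (lookup (y ∷ w)) (sym (proj₂ f′ i))) (eq i))) (#-mono z y w)
  where
  f>0 : ∀ i → zero {n} <ᶠ f i
  f>0 zero = subst (zero {n} <ᶠ_) (sym f0) z<s
  f>0 (suc i) = <-trans (f>0 zero) (inc zero (suc i) z<s)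
  f′ = lower f f>0

σ-contained : ∀ {k n} {w : Vec ℕ n} → RG w → k ≤ blocks w → Contains (partition w) (σ k)
σ-contained {k} {w = w} rg k≤r =
  let f , inc , inj = representatives rg k≤r in
  f , inc , λ i j → trans (⇔→≡ (mk⇔
    (λ p → dec-true (i Fin.≟ j) (inj i j (kernel⁻ w p)))
    (λ p → kernel⁺ w (cong (λ i → lookup w (f i)) (does⇒ (i Fin.≟ j) p)))))
    (sym (∼-fromFunction (λ i j → does (i Fin.≟ j)) i j))

σ-avoided : ∀ {k n} (w : Vec ℕ n) → blocks w < k → Avoids (partition w) (σ k)
σ-avoided w r<k (f , _ , same) with pigeonhole r<k (λ i → fromℕ< (lookup<blocks w (f i)))
... | i , j , i<j , eq = <⇒≢ i<j (cong toℕ (does⇒ (i Fin.≟ j)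
  (trans (sym (∼-fromFunction (λ i j → does (i Fin.≟ j)) i j)) (trans (sym (same i j))
    (kernel⁺ w (fromℕ<-injective _ _ _ _ eq))))))

β-contained : ∀ {k n z} (w : Vec ℕ n) → k ≤ # z ∈ w → Contains (partition w) (β k)
β-contained w k≤# = let f , inc , eq = copies w k≤# in
  f , inc , λ i j → trans (kernel⁺ w (trans (eq i) (sym (eq j))))
    (sym (∼-fromFunction (λ _ _ → true) i j))

β-avoided : ∀ {m n} (w : Vec ℕ n) → (∀ z → # z ∈ w ≤ m) → Avoids (partition w) (β (suc m))
β-avoided w #≤m (f , inc , same) = <-irrefl refl (≤-trans
  (copies-bound w f inc λ i →
    kernel⁻ w (trans (same i zero) (∼-fromFunction (λ _ _ → true) i zero)))
  (#≤m (lookup w (f zero))))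

-- From lists of words to cardinalities

lookup-injective : ∀ {A : Set} {xs : List A} → Unique xs →
  ∀ i j → List.lookup xs i ≡ List.lookup xs j → i ≡ j
lookup-injective (_ ∷ _) zero zero _ = refl
lookup-injective (x∉ ∷ _) zero (suc j) eq = contradiction eq (All.lookup x∉ (∈-lookup j))
lookup-injective (x∉ ∷ _) (suc i) zero eq = contradiction (sym eq) (All.lookup x∉ (∈-lookup i))
lookup-injective (_ ∷ u) (suc i) (suc j) eq = cong suc (lookup-injective u i j eq)

map-unique : ∀ {A B : Set} {P : A → Set} {f : A → B} →
  (∀ {x y} → P x → P y → f x ≡ f y → x ≡ y) →
  ∀ {xs} → All P xs → Unique xs → Unique (map f xs)
map-unique inj [] [] = []
map-unique inj (p ∷ ps) (x∉ ∷ u) =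
  All.map⁺ (All.zipWith (λ (q , x≢y) eq → x≢y (inj p q eq)) (ps , x∉)) ∷ map-unique inj ps u

Π-≡ : ∀ {k n} {τ : SetPartition k} {p q : Π n τ} → rel (Π.part p) ≡ rel (Π.part q) → p ≡ q
Π-≡ {p = mkΠ (mkSP _ _) _} {mkΠ (mkSP _ _) _} refl = refl

module _ {k n : ℕ} {τ : SetPartition k} (L : List (Rel n)) (unique : Unique L)
  (sound : All (λ R → Σ (IsEquivalenceRel R) λ e → Avoids (mkSP R e) τ) L)
  (complete : ∀ R (e : IsEquivalenceRel R) → Avoids (mkSP R e) τ → R ∈ L) where

  open import Data.List.Membership.DecPropositional (≡-dec {n = n} (≡-dec {n = n} Bool._≟_)) using (_∈?_)

  -- `e` and `av` are irrelevant and cannot enter the result directly; equality of Boolean matrices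
  -- is decidable, so the membership proof can be recomputed.
  listed : (p : Π n τ) → rel (Π.part p) ∈ L
  listed (mkΠ (mkSP R e) av) = recompute (R ∈? L) (complete R e av)

  enumerated-size : HasSize (Π n τ) (length L)
  enumerated-size = mk↔ₛ′ (λ p → Any.index (listed p)) nth
    (λ i → lookup-injective unique _ i (sym (lookup-index (listed (nth i)))))
    (λ p → Π-≡ (sym (lookup-index (listed p))))
    where
    nth : Fin (length L) → Π n τ
    nth i = let e , av = All.lookup sound (∈-lookup i) in mkΠ (mkSP (List.lookup L i) e) av

module _ (D s : ℕ) {k : ℕ} {τ : SetPartition k} where

  open Enumeration D s

  avoiders-size : ∀ {n} → (∀ {w : Vec ℕ n} → Good w → Avoids (partition w) τ) →
    (∀ {w : Vec ℕ n} → RG w → Avoids (partition w) τ → Good w) →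
    HasSize (Π n τ) (exp-trunc (head< s) D n)
  avoiders-size {n} good⇒avoids avoids⇒good = subst (HasSize (Π n τ))
    (trans (length-map (λ w → rel (partition w)) (words n)) (length-words n))
    (enumerated-size (map (λ w → rel (partition w)) (words n))
      (map-unique (λ g g′ → partition-injective (proj₁ g) (proj₁ g′)) (words-good n) (words-unique n))
      (All.map⁺ (All.map (λ {w} g → kernel-equiv w , good⇒avoids g) (words-good n)))
      complete)
    where
    complete : ∀ R (e : IsEquivalenceRel R) → Avoids (mkSP R e) τ →
      R ∈ map (λ w → rel (partition w)) (words n)
    complete R e av with partition-surjective R e
    ... | w , rg , refl = ∈-map⁺ (λ w → rel (partition w)) (good⇒∈words (avoids⇒good rg av))

-- No letter occurs more than `n` times in a word of length `n`, so the size bound `n` excludes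
-- nothing; `β-size` likewise takes `n` to bound the number of blocks.
σ-size : ∀ m n → HasSize (Π n (σ (suc m))) (exp-trunc (head< n) m n)
σ-size m n = avoiders-size m n
  (λ {w} (_ , r≤m , _) → σ-avoided w (s≤s r≤m))
  (λ {w} rg av → rg , ≮⇒≥ (λ m<r → av (σ-contained rg m<r)) , λ z → count≤n (z ≟_) w)

β-size : ∀ m n → HasSize (Π n (β (suc m))) (exp-trunc (head< m) n n)
β-size m n = avoiders-size n m
  (λ {w} (_ , _ , #≤m) → β-avoided w #≤m)
  (λ {w} rg av → rg , blocks≤n rg , λ z → ≮⇒≥ (λ m<# → av (β-contained w m<#)))

theorem3p5 : (k n : ℕ) → 2 ≤ k → 1 ≤ n →
    Σ ℕ λ a → Σ ℕ λ b →
    HasSize (Π n (σ k)) a × HasSize (Π n (β k)) b ×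
    a ≤ b × (k < n → 2 < k → a < b)
theorem3p5 k@(suc (suc M)) n (s≤s (s≤s z≤n)) _ =
  exp-trunc (head< n) (suc M) n , exp-trunc (head< (suc M)) n n ,
  σ-size (suc M) n , β-size (suc M) n ,
  ≤-trans σ≤bell (bell≤ M n n ≤-refl) ,
  λ { k<n (s≤s (s≤s 1≤M)) → ≤-<-trans σ≤bell (bell< M 1≤M n k<n) }
  where
  -- The size bound `n` left `head< n` in place of eˣ. One inequality is enough, since the chain
  -- passes through `exp-trunc exp (suc M)`, which is G_m.
  σ≤bell : exp-trunc (head< n) (suc M) n ≤ exp-trunc exp (suc M) n
  σ≤bell = exp-trunc-mono (suc M) (head≼exp n) n
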